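{- Let $n\geq 3$ be an odd integer. For a nonnegative integer $r$, let $s_{n-1}(r)$ denote the sum of the digits of $r$ in base $n-1$, and for $x\in\mathbb{N}$ define $$S_n(x)=\sum_{0\leq r<x,\; r\equiv 0 \pmod n}(-1)^{s_{n-1}(r)}.$$ Then $$\sum_{j=0}^{\frac{n-1}{2}}(-1)^j\binom{n}{2j+1}S_n\big((n-1)^{2j}\big)=1.$$ Equivalently, with $\sigma(n,j)=\sum_{k=1}^{\frac{n-1}{2}}\tan^{2j}\frac{\pi k}{n}$, $$\sum_{j=1}^{\frac{n-1}{2}}(-1)^{j-1}\binom{n}{2j+1}\sigma(n,j)=\binom{n}{2}.$$ -}

module Defs where

open import Data.Nat using (ℕ; zero; suc; _+_; _*_; _^_; _%_; _/_; NonZero)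
open import Data.Integer using (ℤ; +_; -_)
open import Data.Nat.Combinatorics using (_C_)
open import Data.Bool using (if_then_else_)
open import Relation.Nullary.Decidable using (⌊_⌋)
open import Data.Nat using (_≟_)

-- digit sum of r in base b (b ≥ 2), computed with fuel; fuel = r suffices
-- because each step strictly decreases r (r / b < r for r ≥ 1, b ≥ 2).
digitSumFuel : (b : ℕ) → .{{NonZero b}} → ℕ → ℕ → ℕ
digitSumFuel b zero    r = 0
digitSumFuel b (suc f) r = r % b + digitSumFuel b f (r / b)

digitSum : (b : ℕ) → .{{NonZero b}} → ℕ → ℕ
digitSum b r = digitSumFuel b r r

negOnePow : ℕ → ℤ
negOnePow zero    = + 1
negOnePow (suc k) = - negOnePow k

sumBelow : ℕ → (ℕ → ℤ) → ℤ
sumBelow zero    f = + 0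
sumBelow (suc x) f = sumBelow x f Data.Integer.+ f x

S : (n : ℕ) → .{{NonZero n}} → .{{NonZero (n Data.Nat.∸ 1)}} → ℕ → ℤ
S n x = sumBelow x (λ r → if ⌊ r % n ≟ 0 ⌋ then negOnePow (digitSum (n Data.Nat.∸ 1) r) else + 0)

{-# OPTIONS --safe #-}

-- Put b = n - 1 ≡ -1 (mod n) and work with n-periodic integer sequences, σ being the
-- shift u ↦ u (· + b). Splitting off the lowest base-b digit shows that the signed counts
-- v N k = Σ_{r < b^N, r ≡ k (mod n)} (-1)^(s_b r) satisfy v (N + 1) = M (v N) for
-- (M u) k = Σ_{d < b} (-1)^d u (k b + d), so the theorem is about M^(2j) (v 0) at 0.
-- Because b² ≡ 1 (mod n), M is a discrete Cayley transform of σ: (1 + σ)² M² = -(1 - σ)²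
-- (the tan (π k / n) of the trigonometric form). Hence (1 + σ)^n times the real and imaginary
-- parts of (1 + i M)^n (v 0) are governed by (1 + σ ± (1 - σ))^n = 2^n, (2σ)^n, which agree
-- as σ^n = 1; this forces (1 + σ)^n (1 - σ) B = 0 for the odd binomial sum B. Since n is odd,
-- 1 + σ is injective, so B is constant, and summing over a period (where M² sums to 0 and
-- v 0 to 1) shows that the constant is 1.

module Submission where

open import Defs

module AlternatingDigitSums where

  open import Data.Nat
    using (ℕ; zero; suc; NonZero; _<_; _≤_; z≤n; s≤s; _%_; _/_; _≟_)
    renaming (_+_ to _+ₙ_; _*_ to _*ₙ_; _^_ to _^ₙ_)
  import Data.Nat.Properties as ℕₚ
  open import Data.Nat.DivMod
    using (m<n⇒m%n≡m; [m+kn]%n≡m%n; +-distrib-/-∣ʳ; m<n⇒m/n≡0; m*n/n≡m; m/n<m; 0/n≡0)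
  open import Data.Nat.Divisibility
    using (_∣_; n∣m*n; ∣m+n∣m⇒∣n; ∣m∣n⇒∣m+n; m%n≡0⇒n∣m; n∣m⇒m%n≡0; ∣⇒≤)
  open import Data.Nat.Combinatorics using (_C_; nCk+nC[k+1]≡[n+1]C[k+1]; k>n⇒nCk≡0)
  import Data.Nat.Tactic.RingSolver as ℕ-Solver
  open import Data.Integer using (ℤ; +_; -_; _+_; _-_; _*_; _^_)
  import Data.Integer.Properties as ℤₚ
  open import Data.Integer.Tactic.RingSolver using (solve-∀)
  open import Relation.Binary.PropositionalEquality
    using (_≡_; _≗_; refl; sym; trans; cong; cong₂; subst; module ≡-Reasoning)
  open import Data.Bool using (if_then_else_)
  open import Relation.Nullary using (¬_; yes; no; contradiction)
  open import Relation.Nullary.Decidable using (⌊_⌋)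

  Seq : Set
  Seq = ℕ → ℤ

  sumBelow-cong : ∀ K {f g : Seq} → f ≗ g → sumBelow K f ≡ sumBelow K g
  sumBelow-cong zero    f≗g = refl
  sumBelow-cong (suc K) f≗g = cong₂ _+_ (sumBelow-cong K f≗g) (f≗g K)

  sumBelow-cong< : ∀ K {f g : Seq} → (∀ i → i < K → f i ≡ g i) →
                   sumBelow K f ≡ sumBelow K g
  sumBelow-cong< zero    eq = refl
  sumBelow-cong< (suc K) eq =
    cong₂ _+_ (sumBelow-cong< K (λ i i<K → eq i (ℕₚ.m<n⇒m<1+n i<K))) (eq K (ℕₚ.n<1+n K))

  sumBelow-+ : ∀ K (f g : Seq) →
               sumBelow K (λ i → f i + g i) ≡ sumBelow K f + sumBelow K g
  sumBelow-+ zero    f g = refl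
  sumBelow-+ (suc K) f g rewrite sumBelow-+ K f g = interchange (sumBelow K f) (sumBelow K g) (f K) (g K)
    where
    interchange : ∀ a b c d → a + b + (c + d) ≡ a + c + (b + d)
    interchange = solve-∀

  sumBelow-*ˡ : ∀ K c (f : Seq) → sumBelow K (λ i → c * f i) ≡ c * sumBelow K f
  sumBelow-*ˡ zero    c f = sym (ℤₚ.*-zeroʳ c)
  sumBelow-*ˡ (suc K) c f rewrite sumBelow-*ˡ K c f =
    sym (ℤₚ.*-distribˡ-+ c (sumBelow K f) (f K))

  sumBelow-neg : ∀ K (f : Seq) → sumBelow K (λ i → - f i) ≡ - sumBelow K f
  sumBelow-neg zero    f = refl
  sumBelow-neg (suc K) f rewrite sumBelow-neg K f =
    sym (ℤₚ.neg-distrib-+ (sumBelow K f) (f K))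

  sumBelow-const : ∀ K c → sumBelow K (λ _ → c) ≡ + K * c
  sumBelow-const zero    c = refl
  sumBelow-const (suc K) c rewrite sumBelow-const K c = step (+ K) c
    where
    step : ∀ k c → k * c + c ≡ (+ 1 + k) * c
    step = solve-∀

  sumBelow-zero : ∀ K → sumBelow K (λ _ → + 0) ≡ + 0
  sumBelow-zero K = trans (sumBelow-const K (+ 0)) (ℤₚ.*-zeroʳ (+ K))

  sumBelow-swap : ∀ K L (f : ℕ → ℕ → ℤ) →
                  sumBelow K (λ i → sumBelow L (f i)) ≡ sumBelow L (λ j → sumBelow K (λ i → f i j))
  sumBelow-swap zero    L f = sym (sumBelow-zero L)
  sumBelow-swap (suc K) L f rewrite sumBelow-swap K L f =
    sym (sumBelow-+ L (λ j → sumBelow K (λ i → f i j)) (f K))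

  sumBelow-suc : ∀ K (f : Seq) → sumBelow (suc K) f ≡ f 0 + sumBelow K (λ i → f (suc i))
  sumBelow-suc zero    f = ℤₚ.+-comm (+ 0) (f 0)
  sumBelow-suc (suc K) f rewrite sumBelow-suc K f =
    ℤₚ.+-assoc (f 0) (sumBelow K (λ i → f (suc i))) (f (suc K))

  sumBelow-split : ∀ K L (f : Seq) →
                   sumBelow (K +ₙ L) f ≡ sumBelow K f + sumBelow L (λ i → f (K +ₙ i))
  sumBelow-split K zero    f rewrite ℕₚ.+-identityʳ K = sym (ℤₚ.+-identityʳ _)
  sumBelow-split K (suc L) f rewrite ℕₚ.+-suc K L | sumBelow-split K L f =
    ℤₚ.+-assoc (sumBelow K f) (sumBelow L (λ i → f (K +ₙ i))) (f (K +ₙ L))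

  sumBelow-zeroTail : ∀ K L (f : Seq) → (∀ i → f (K +ₙ i) ≡ + 0) →
                      sumBelow (K +ₙ L) f ≡ sumBelow K f
  sumBelow-zeroTail K L f tail≡0 = begin
    sumBelow (K +ₙ L) f                              ≡⟨ sumBelow-split K L f ⟩
    sumBelow K f + sumBelow L (λ i → f (K +ₙ i))      ≡⟨ cong (_+_ (sumBelow K f)) (sumBelow-cong L tail≡0) ⟩
    sumBelow K f + sumBelow L (λ _ → + 0)             ≡⟨ cong (_+_ (sumBelow K f)) (sumBelow-zero L) ⟩
    sumBelow K f + + 0                               ≡⟨ ℤₚ.+-identityʳ _ ⟩
    sumBelow K f                                     ∎
    where open ≡-Reasoning

  sumBelow-blocks : ∀ b K (f : Seq) →
                    sumBelow (b *ₙ K) f ≡ sumBelow K (λ q → sumBelow b (λ d → f (d +ₙ q *ₙ b)))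
  sumBelow-blocks b zero    f rewrite ℕₚ.*-zeroʳ b = refl
  sumBelow-blocks b (suc K) f rewrite ℕₚ.*-suc b K | ℕₚ.+-comm b (b *ₙ K) =
    trans (sumBelow-split (b *ₙ K) b f)
          (cong₂ _+_ (sumBelow-blocks b K f) (sumBelow-cong b (λ d → cong f (reorder b K d))))
    where
    reorder : ∀ b K d → b *ₙ K +ₙ d ≡ d +ₙ K *ₙ b
    reorder = ℕ-Solver.solve-∀

  negOnePow-+ : ∀ a c → negOnePow (a +ₙ c) ≡ negOnePow a * negOnePow c
  negOnePow-+ zero    c = sym (ℤₚ.*-identityˡ (negOnePow c))
  negOnePow-+ (suc a) c rewrite negOnePow-+ a c = ℤₚ.neg-distribˡ-* (negOnePow a) (negOnePow c)

  negOnePow-2* : ∀ k → negOnePow (2 *ₙ k) ≡ + 1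
  negOnePow-2* zero    = refl
  negOnePow-2* (suc k) rewrite ℕₚ.+-suc k (k +ₙ 0) =
    trans (ℤₚ.neg-involutive _) (negOnePow-2* k)

  sumBelow-alternating-telescope : ∀ L (g : Seq) →
    sumBelow L (λ d → negOnePow d * (g d + g (suc d))) ≡ g 0 - negOnePow L * g L
  sumBelow-alternating-telescope zero    g = cancel (g 0)
    where
    cancel : ∀ a → + 0 ≡ a - + 1 * a
    cancel = solve-∀
  sumBelow-alternating-telescope (suc L) g rewrite sumBelow-alternating-telescope L g =
    step (g 0) (negOnePow L) (g L) (g (suc L))
    where
    step : ∀ a s x y → a - s * x + s * (x + y) ≡ a - (- s) * y
    step = solve-∀

  module Digits (b : ℕ) .{{_ : NonZero b}} (1<b : 1 < b) where

    0%b≡0 : 0 % b ≡ 0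
    0%b≡0 = m<n⇒m%n≡m (ℕₚ.<⇒≤ 1<b)

    digitSumFuel-zero : ∀ f → digitSumFuel b f 0 ≡ 0
    digitSumFuel-zero zero    = refl
    digitSumFuel-zero (suc f) =
      trans (cong₂ _+ₙ_ 0%b≡0 (cong (digitSumFuel b f) (0/n≡0 b))) (digitSumFuel-zero f)

    /-≤-pred : ∀ x f → x ≤ suc f → x / b ≤ f
    /-≤-pred zero    f _   = subst (_≤ f) (sym (0/n≡0 b)) z≤n
    /-≤-pred (suc x) f x≤f = ℕₚ.≤-pred (ℕₚ.≤-trans (m/n<m (suc x) b 1<b) x≤f)

    digitSumFuel-irrelevant : ∀ f g x → x ≤ f → x ≤ g → digitSumFuel b f x ≡ digitSumFuel b g x
    digitSumFuel-irrelevant zero    zero    x       _   _   = refl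
    digitSumFuel-irrelevant zero    (suc g) .0      z≤n _   = sym (digitSumFuel-zero (suc g))
    digitSumFuel-irrelevant (suc f) zero    .0      _   z≤n = digitSumFuel-zero (suc f)
    digitSumFuel-irrelevant (suc f) (suc g) x       x≤f x≤g =
      cong (x % b +ₙ_) (digitSumFuel-irrelevant f g (x / b) (/-≤-pred x f x≤f) (/-≤-pred x g x≤g))

    digitSum-unfold : ∀ x → digitSum b x ≡ x % b +ₙ digitSum b (x / b)
    digitSum-unfold zero    = sym (cong₂ _+ₙ_ 0%b≡0 (cong (digitSum b) (0/n≡0 b)))
    digitSum-unfold (suc x) = cong (suc x % b +ₙ_)
      (digitSumFuel-irrelevant x (suc x / b) (suc x / b) (/-≤-pred (suc x) x ℕₚ.≤-refl) ℕₚ.≤-refl)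

    digitSum-+digit : ∀ {d} q → d < b → digitSum b (d +ₙ q *ₙ b) ≡ d +ₙ digitSum b q
    digitSum-+digit {d} q d<b =
      trans (digitSum-unfold (d +ₙ q *ₙ b)) (cong₂ _+ₙ_ lowDigit (cong (digitSum b) quotient))
      where
      lowDigit : (d +ₙ q *ₙ b) % b ≡ d
      lowDigit = trans ([m+kn]%n≡m%n d q b) (m<n⇒m%n≡m d<b)
      quotient : (d +ₙ q *ₙ b) / b ≡ q
      quotient = trans (+-distrib-/-∣ʳ d (n∣m*n q)) (cong₂ _+ₙ_ (m<n⇒m/n≡0 d<b) (m*n/n≡m q b))


  -- With x j = y ^ (2 j), these are the real part of (1 + i y) ^ N and its imaginary part divided by y.
  evenBinomialSum oddBinomialSum : ℕ → (ℕ → ℤ) → ℤ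
  evenBinomialSum N x = sumBelow (suc N) (λ j → negOnePow j * (+ (N C (2 *ₙ j)) * x j))
  oddBinomialSum  N x = sumBelow (suc N) (λ j → negOnePow j * (+ (N C (2 *ₙ j +ₙ 1)) * x j))

  binomialTerm-vanishes : ∀ {N k} s y → N < k → s * (+ (N C k) * y) ≡ + 0
  binomialTerm-vanishes s y N<k rewrite k>n⇒nCk≡0 N<k = ℤₚ.*-zeroʳ s

  2[1+j]≡1+[2j+1] : ∀ j → 2 *ₙ suc j ≡ suc (2 *ₙ j +ₙ 1)
  2[1+j]≡1+[2j+1] = ℕ-Solver.solve-∀

  2j+1≡1+2j : ∀ j → 2 *ₙ j +ₙ 1 ≡ suc (2 *ₙ j)
  2j+1≡1+2j = ℕ-Solver.solve-∀

  pascal-even : ∀ N j → suc N C (2 *ₙ suc j) ≡ N C (2 *ₙ j +ₙ 1) +ₙ N C (2 *ₙ suc j)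
  pascal-even N j =
    trans (cong (suc N C_) (2[1+j]≡1+[2j+1] j))
          (trans (sym (nCk+nC[k+1]≡[n+1]C[k+1] N (2 *ₙ j +ₙ 1)))
                 (cong (λ k → N C (2 *ₙ j +ₙ 1) +ₙ N C k) (sym (2[1+j]≡1+[2j+1] j))))

  pascal-odd : ∀ N j → suc N C (2 *ₙ j +ₙ 1) ≡ N C (2 *ₙ j) +ₙ N C (2 *ₙ j +ₙ 1)
  pascal-odd N j =
    trans (cong (suc N C_) (2j+1≡1+2j j))
          (trans (sym (nCk+nC[k+1]≡[n+1]C[k+1] N (2 *ₙ j)))
                 (cong (λ k → N C (2 *ₙ j) +ₙ N C k) (sym (2j+1≡1+2j j))))

  N<2[1+N] : ∀ N → N < 2 *ₙ suc N
  N<2[1+N] N = ℕₚ.m≤m+n (suc N) (suc N +ₙ 0)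

  evenBinomialSum-suc : ∀ N x →
    evenBinomialSum (suc N) x ≡ evenBinomialSum N x - oddBinomialSum N (λ j → x (suc j))
  evenBinomialSum-suc N x = begin
    evenBinomialSum (suc N) x
      ≡⟨ sumBelow-suc (suc N) _ ⟩
    a 0 + sumBelow (suc N) (λ j → negOnePow (suc j) * (+ (suc N C (2 *ₙ suc j)) * x (suc j)))
      ≡⟨ cong (_+_ (a 0)) (sumBelow-cong (suc N) pascal-split) ⟩
    a 0 + sumBelow (suc N) (λ j → a (suc j) + - o j)
      ≡⟨ cong (_+_ (a 0)) (sumBelow-+ (suc N) (λ j → a (suc j)) (λ j → - o j)) ⟩
    a 0 + (sumBelow (suc N) (λ j → a (suc j)) + sumBelow (suc N) (λ j → - o j))
      ≡⟨ sym (ℤₚ.+-assoc (a 0) _ _) ⟩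
    a 0 + sumBelow (suc N) (λ j → a (suc j)) + sumBelow (suc N) (λ j → - o j)
      ≡⟨ cong₂ _+_ (sym (sumBelow-suc (suc N) a)) (sumBelow-neg (suc N) o) ⟩
    evenBinomialSum N x + a (suc N) - oddBinomialSum N (λ j → x (suc j))
      ≡⟨ cong (λ t → evenBinomialSum N x + t - oddBinomialSum N (λ j → x (suc j)))
              (binomialTerm-vanishes (negOnePow (suc N)) (x (suc N)) (N<2[1+N] N)) ⟩
    evenBinomialSum N x + + 0 - oddBinomialSum N (λ j → x (suc j))
      ≡⟨ cong (_- oddBinomialSum N (λ j → x (suc j))) (ℤₚ.+-identityʳ (evenBinomialSum N x)) ⟩
    evenBinomialSum N x - oddBinomialSum N (λ j → x (suc j))
      ∎
    where
    open ≡-Reasoning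
    a o : ℕ → ℤ
    a j = negOnePow j * (+ (N C (2 *ₙ j)) * x j)
    o j = negOnePow j * (+ (N C (2 *ₙ j +ₙ 1)) * x (suc j))
    distrib : ∀ s p q y → - s * ((p + q) * y) ≡ - s * (q * y) + - (s * (p * y))
    distrib = solve-∀
    pascal-split : ∀ j → negOnePow (suc j) * (+ (suc N C (2 *ₙ suc j)) * x (suc j)) ≡ a (suc j) + - o j
    pascal-split j rewrite pascal-even N j =
      distrib (negOnePow j) (+ (N C (2 *ₙ j +ₙ 1))) (+ (N C (2 *ₙ suc j))) (x (suc j))

  oddBinomialSum-suc : ∀ N x → oddBinomialSum (suc N) x ≡ oddBinomialSum N x + evenBinomialSum N x
  oddBinomialSum-suc N x = begin
    oddBinomialSum (suc N) x
      ≡⟨ sumBelow-cong (suc (suc N)) pascal-split ⟩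
    sumBelow (suc (suc N)) (λ j → o j + a j)
      ≡⟨ sumBelow-+ (suc (suc N)) o a ⟩
    (oddBinomialSum N x + o (suc N)) + (evenBinomialSum N x + a (suc N))
      ≡⟨ cong₂ (λ s t → (oddBinomialSum N x + s) + (evenBinomialSum N x + t))
              (binomialTerm-vanishes {k = 2 *ₙ suc N +ₙ 1} (negOnePow (suc N)) (x (suc N))
                                     (ℕₚ.≤-trans (N<2[1+N] N) (ℕₚ.m≤m+n _ 1)))
              (binomialTerm-vanishes (negOnePow (suc N)) (x (suc N)) (N<2[1+N] N)) ⟩
    (oddBinomialSum N x + + 0) + (evenBinomialSum N x + + 0)
      ≡⟨ cong₂ _+_ (ℤₚ.+-identityʳ (oddBinomialSum N x)) (ℤₚ.+-identityʳ (evenBinomialSum N x)) ⟩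
    oddBinomialSum N x + evenBinomialSum N x
      ∎
    where
    open ≡-Reasoning
    a o : ℕ → ℤ
    a j = negOnePow j * (+ (N C (2 *ₙ j)) * x j)
    o j = negOnePow j * (+ (N C (2 *ₙ j +ₙ 1)) * x j)
    distrib : ∀ s p q y → s * ((p + q) * y) ≡ s * (q * y) + s * (p * y)
    distrib = solve-∀
    pascal-split : ∀ j → negOnePow j * (+ (suc N C (2 *ₙ j +ₙ 1)) * x j) ≡ o j + a j
    pascal-split j rewrite pascal-odd N j =
      distrib (negOnePow j) (+ (N C (2 *ₙ j))) (+ (N C (2 *ₙ j +ₙ 1))) (x j)

  oddBinomialSum-half : ∀ N K x → K +ₙ K ≡ suc N →
    sumBelow K (λ j → negOnePow j * (+ (N C (2 *ₙ j +ₙ 1)) * x j)) ≡ oddBinomialSum N x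
  oddBinomialSum-half N K x K+K≡1+N = begin
    sumBelow K o
      ≡⟨ sumBelow-zeroTail K K o (λ i → binomialTerm-vanishes (negOnePow (K +ₙ i)) (x (K +ₙ i)) (beyondHalf i)) ⟨
    sumBelow (K +ₙ K) o
      ≡⟨ cong (λ L → sumBelow L o) K+K≡1+N ⟩
    oddBinomialSum N x
      ∎
    where
    open ≡-Reasoning
    o : ℕ → ℤ
    o j = negOnePow j * (+ (N C (2 *ₙ j +ₙ 1)) * x j)
    beyondHalf : ∀ i → N < 2 *ₙ (K +ₙ i) +ₙ 1
    beyondHalf i = ℕₚ.≤-trans (ℕₚ.≤-reflexive (sym K+K≡1+N))
      (ℕₚ.≤-trans (ℕₚ.m≤m+n (K +ₙ K) (i +ₙ i +ₙ 1)) (ℕₚ.≤-reflexive (rearrange K i)))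
      where
      rearrange : ∀ K i → K +ₙ K +ₙ (i +ₙ i +ₙ 1) ≡ 2 *ₙ (K +ₙ i) +ₙ 1
      rearrange = ℕ-Solver.solve-∀

  module OddModulus (b : ℕ) .{{_ : NonZero b}} (1<b : 1 < b) (b-even : negOnePow b ≡ + 1) where

    open Digits b 1<b

    n : ℕ
    n = suc b

    ifMultiple : ℕ → ℤ → ℤ
    ifMultiple x z = if ⌊ x % n ≟ 0 ⌋ then z else + 0

    ifMultiple-⇔ : ∀ x y z → (n ∣ x → n ∣ y) → (n ∣ y → n ∣ x) → ifMultiple x z ≡ ifMultiple y z
    ifMultiple-⇔ x y z x⇒y y⇒x with x % n ≟ 0 | y % n ≟ 0
    ... | yes _     | yes _     = refl
    ... | no  _     | no  _     = refl
    ... | yes x%n≡0 | no  y%n≢0 =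
      contradiction (n∣m⇒m%n≡0 y n (x⇒y (m%n≡0⇒n∣m x n x%n≡0))) y%n≢0
    ... | no  x%n≢0 | yes y%n≡0 =
      contradiction (n∣m⇒m%n≡0 x n (y⇒x (m%n≡0⇒n∣m y n y%n≡0))) x%n≢0

    ifMultiple-* : ∀ x c z → ifMultiple x (c * z) ≡ c * ifMultiple x z
    ifMultiple-* x c z with x % n ≟ 0
    ... | yes _ = refl
    ... | no  _ = sym (ℤₚ.*-zeroʳ c)

    ifMultiple-∤ : ∀ {x} z → ¬ n ∣ x → ifMultiple x z ≡ + 0
    ifMultiple-∤ {x} z n∤x with x % n ≟ 0
    ... | yes x%n≡0 = contradiction (m%n≡0⇒n∣m x n x%n≡0) n∤x
    ... | no  _     = refl

    ifMultiple-+multiple : ∀ {x} a t z → x ≡ a +ₙ t *ₙ n → ifMultiple x z ≡ ifMultiple a z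
    ifMultiple-+multiple a t z refl = ifMultiple-⇔ (a +ₙ t *ₙ n) a z
      (λ n∣x → ∣m+n∣m⇒∣n (subst (n ∣_) (ℕₚ.+-comm a (t *ₙ n)) n∣x) (n∣m*n t))
      (λ n∣a → ∣m∣n⇒∣m+n n∣a (n∣m*n t))

    ifMultiple-complement : ∀ x y t z → x +ₙ y ≡ t *ₙ n → ifMultiple x z ≡ ifMultiple y z
    ifMultiple-complement x y t z x+y≡tn = ifMultiple-⇔ x y z
      (λ n∣x → ∣m+n∣m⇒∣n (subst (n ∣_) (sym x+y≡tn) (n∣m*n t)) n∣x)
      (λ n∣y → ∣m+n∣m⇒∣n (subst (n ∣_) (trans (sym x+y≡tn) (ℕₚ.+-comm x y)) (n∣m*n t)) n∣y)

    -- As k * b + r ≡ r - k (mod n), v N k sums (-1)^(s_b r) over r < b^N with r ≡ k (mod n);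
    -- written this way, v N 0 is S n (b ^ N) on the nose.
    signedIndicator : ℕ → ℕ → ℤ
    signedIndicator k r = ifMultiple (k *ₙ b +ₙ r) (negOnePow (digitSum b r))

    v : ℕ → Seq
    v N k = sumBelow (b ^ₙ N) (signedIndicator k)

    M : Seq → Seq
    M u k = sumBelow b (λ d → negOnePow d * u (k *ₙ b +ₙ d))

    M-cong : ∀ {u w} → u ≗ w → M u ≗ M w
    M-cong u≗w k = sumBelow-cong b (λ d → cong (negOnePow d *_) (u≗w (k *ₙ b +ₙ d)))

    signedIndicator-lowestDigit : ∀ k q {d} → d < b →
      signedIndicator k (d +ₙ q *ₙ b) ≡ negOnePow d * signedIndicator (k *ₙ b +ₙ d) q
    signedIndicator-lowestDigit k q {d} d<b = begin
      ifMultiple x (negOnePow (digitSum b (d +ₙ q *ₙ b)))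
        ≡⟨ cong (λ s → ifMultiple x (negOnePow s)) (digitSum-+digit q d<b) ⟩
      ifMultiple x (negOnePow (d +ₙ digitSum b q))
        ≡⟨ cong (ifMultiple x) (negOnePow-+ d (digitSum b q)) ⟩
      ifMultiple x (negOnePow d * negOnePow (digitSum b q))
        ≡⟨ ifMultiple-* x (negOnePow d) (negOnePow (digitSum b q)) ⟩
      negOnePow d * ifMultiple x (negOnePow (digitSum b q))
        ≡⟨ cong (negOnePow d *_)
                (ifMultiple-complement x y (k *ₙ b +ₙ d +ₙ q) _ (complementary k b d q)) ⟩
      negOnePow d * ifMultiple y (negOnePow (digitSum b q))
        ∎
      where
      open ≡-Reasoning
      x = k *ₙ b +ₙ (d +ₙ q *ₙ b)
      y = (k *ₙ b +ₙ d) *ₙ b +ₙ q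
      complementary : ∀ k b d q →
        k *ₙ b +ₙ (d +ₙ q *ₙ b) +ₙ ((k *ₙ b +ₙ d) *ₙ b +ₙ q) ≡ (k *ₙ b +ₙ d +ₙ q) *ₙ (1 +ₙ b)
      complementary = ℕ-Solver.solve-∀

    v-suc : ∀ N → v (suc N) ≗ M (v N)
    v-suc N k = begin
      v (suc N) k
        ≡⟨ sumBelow-blocks b (b ^ₙ N) (signedIndicator k) ⟩
      sumBelow (b ^ₙ N) (λ q → sumBelow b (λ d → signedIndicator k (d +ₙ q *ₙ b)))
        ≡⟨ sumBelow-cong (b ^ₙ N) (λ q → sumBelow-cong< b (λ d → signedIndicator-lowestDigit k q)) ⟩
      sumBelow (b ^ₙ N) (λ q → sumBelow b (λ d → negOnePow d * signedIndicator (k *ₙ b +ₙ d) q))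
        ≡⟨ sumBelow-swap (b ^ₙ N) b _ ⟩
      sumBelow b (λ d → sumBelow (b ^ₙ N) (λ q → negOnePow d * signedIndicator (k *ₙ b +ₙ d) q))
        ≡⟨ sumBelow-cong b (λ d → sumBelow-*ˡ (b ^ₙ N) (negOnePow d) (signedIndicator (k *ₙ b +ₙ d))) ⟩
      M (v N) k
        ∎
      where open ≡-Reasoning

    Periodic : Seq → Set
    Periodic u = ∀ k → u (k +ₙ n) ≡ u k

    periodic-+* : ∀ {u} → Periodic u → ∀ a t → u (a +ₙ t *ₙ n) ≡ u a
    periodic-+* {u} p a zero    = cong u (ℕₚ.+-identityʳ a)
    periodic-+* {u} p a (suc t) =
      trans (cong u (shuffle a t n)) (trans (p (a +ₙ t *ₙ n)) (periodic-+* p a t))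
      where
      shuffle : ∀ a t n → a +ₙ (n +ₙ t *ₙ n) ≡ a +ₙ t *ₙ n +ₙ n
      shuffle = ℕ-Solver.solve-∀

    periodic-≡ : ∀ {u} → Periodic u → ∀ {x a} s t → x +ₙ s *ₙ n ≡ a +ₙ t *ₙ n → u x ≡ u a
    periodic-≡ {u} p {x} {a} s t eq =
      trans (sym (periodic-+* p x s)) (trans (cong u eq) (periodic-+* p a t))

    [k+n]b+r≡kb+r+bn : ∀ k r → (k +ₙ n) *ₙ b +ₙ r ≡ k *ₙ b +ₙ r +ₙ b *ₙ n
    [k+n]b+r≡kb+r+bn k r = shift k b r
      where
      shift : ∀ k b r → (k +ₙ (1 +ₙ b)) *ₙ b +ₙ r ≡ k *ₙ b +ₙ r +ₙ b *ₙ (1 +ₙ b)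
      shift = ℕ-Solver.solve-∀

    v-periodic : ∀ N → Periodic (v N)
    v-periodic N k =
      sumBelow-cong (b ^ₙ N) (λ r → ifMultiple-+multiple (k *ₙ b +ₙ r) b _ ([k+n]b+r≡kb+r+bn k r))

    M-periodic : ∀ {u} → Periodic u → Periodic (M u)
    M-periodic {u} p k = sumBelow-cong b (λ d → cong (negOnePow d *_)
      (trans (cong u ([k+n]b+r≡kb+r+bn k d)) (periodic-+* p (k *ₙ b +ₙ d) b)))

    -- Since b ≡ -1 (mod n), σ shifts a periodic sequence by -1.
    σ 1+σ 1-σ : Seq → Seq
    σ u k = u (k +ₙ b)
    1+σ u k = u k + σ u k
    1-σ u k = u k - σ u k

    σ-periodic : ∀ {u} → Periodic u → Periodic (σ u)
    σ-periodic {u} p k = trans (cong u (rearrange k n b)) (p (k +ₙ b))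
      where
      rearrange : ∀ k n b → k +ₙ n +ₙ b ≡ k +ₙ b +ₙ n
      rearrange = ℕ-Solver.solve-∀

    σ-suc : ∀ {u} → Periodic u → ∀ k → σ u (suc k) ≡ u k
    σ-suc {u} p k = trans (cong u (sym (ℕₚ.+-suc k b))) (p k)

    1+σ-periodic : ∀ {u} → Periodic u → Periodic (1+σ u)
    1+σ-periodic p k = cong₂ _+_ (p k) (σ-periodic p k)

    1-σ-periodic : ∀ {u} → Periodic u → Periodic (1-σ u)
    1-σ-periodic p k = cong₂ _-_ (p k) (σ-periodic p k)

    1+σ-cong : ∀ {u w} → u ≗ w → 1+σ u ≗ 1+σ w
    1+σ-cong u≗w k = cong₂ _+_ (u≗w k) (u≗w (k +ₙ b))

    1-σ-cong : ∀ {u w} → u ≗ w → 1-σ u ≗ 1-σ w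
    1-σ-cong u≗w k = cong₂ _-_ (u≗w k) (u≗w (k +ₙ b))

    1-σ-1+σ : ∀ u → 1-σ (1+σ u) ≗ 1+σ (1-σ u)
    1-σ-1+σ u k = swap (u k) (u (k +ₙ b)) (u (k +ₙ b +ₙ b))
      where
      swap : ∀ x y z → (x + y) - (y + z) ≡ (x - y) + (y - z)
      swap = solve-∀

    shiftedBlocks-telescope : ∀ (u : Seq) c →
      sumBelow b (λ d → negOnePow d * u (c +ₙ d)) + sumBelow b (λ d → negOnePow d * u (c +ₙ suc d))
        ≡ u c - u (c +ₙ b)
    shiftedBlocks-telescope u c = begin
      sumBelow b (λ d → negOnePow d * u (c +ₙ d)) + sumBelow b (λ d → negOnePow d * u (c +ₙ suc d))
        ≡⟨ sumBelow-+ b _ _ ⟨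
      sumBelow b (λ d → negOnePow d * u (c +ₙ d) + negOnePow d * u (c +ₙ suc d))
        ≡⟨ sumBelow-cong b (λ d → sym (ℤₚ.*-distribˡ-+ (negOnePow d) (u (c +ₙ d)) (u (c +ₙ suc d)))) ⟩
      sumBelow b (λ d → negOnePow d * (u (c +ₙ d) + u (c +ₙ suc d)))
        ≡⟨ sumBelow-alternating-telescope b (λ d → u (c +ₙ d)) ⟩
      u (c +ₙ 0) - negOnePow b * u (c +ₙ b)
        ≡⟨ cong₂ (λ x s → u x - s * u (c +ₙ b)) (ℕₚ.+-identityʳ c) b-even ⟩
      u c - + 1 * u (c +ₙ b)
        ≡⟨ cong (_-_ (u c)) (ℤₚ.*-identityˡ (u (c +ₙ b))) ⟩
      u c - u (c +ₙ b)
        ∎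
      where open ≡-Reasoning

    1+σ-M : ∀ {u} → Periodic u → ∀ k → 1+σ (M u) k ≡ u (k *ₙ b) - u (k *ₙ b +ₙ b)
    1+σ-M {u} p k = trans
      (cong (_+_ (M u k)) (sumBelow-cong b (λ d → cong (negOnePow d *_) (periodic-≡ p 1 b (eq k b d)))))
      (shiftedBlocks-telescope u (k *ₙ b))
      where
      eq : ∀ k b d → (k +ₙ b) *ₙ b +ₙ d +ₙ 1 *ₙ (1 +ₙ b) ≡ k *ₙ b +ₙ (1 +ₙ d) +ₙ b *ₙ (1 +ₙ b)
      eq = ℕ-Solver.solve-∀

    M-adjacent : ∀ {u} → Periodic u → ∀ j → M u j + M u (suc j) ≡ u (j *ₙ b +ₙ b) - u (j *ₙ b +ₙ b +ₙ b)
    M-adjacent {u} p j = trans (ℤₚ.+-comm (M u j) (M u (suc j))) (trans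
      (cong₂ _+_ (sumBelow-cong b (λ d → cong (λ x → negOnePow d * u x) (eqˡ j b d)))
                 (sumBelow-cong b (λ d → cong (negOnePow d *_) (periodic-≡ p 1 0 (eqʳ j b d)))))
      (shiftedBlocks-telescope u (j *ₙ b +ₙ b)))
      where
      eqˡ : ∀ j b d → (1 +ₙ j) *ₙ b +ₙ d ≡ j *ₙ b +ₙ b +ₙ d
      eqˡ = ℕ-Solver.solve-∀
      eqʳ : ∀ j b d → j *ₙ b +ₙ d +ₙ 1 *ₙ (1 +ₙ b) ≡ j *ₙ b +ₙ b +ₙ (1 +ₙ d) +ₙ 0 *ₙ (1 +ₙ b)
      eqʳ = ℕ-Solver.solve-∀

    -- b² ≡ 1 (mod n) lets the two applications of M undo each other up to a shift.
    cayley : ∀ {u} → Periodic u → ∀ k → 1+σ (1+σ (M (M u))) k ≡ - 1-σ (1-σ u) k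
    cayley {u} p k = begin
      1+σ (M w) k + 1+σ (M w) (k +ₙ b)
        ≡⟨ cong₂ _+_ (1+σ-M pw k) (1+σ-M pw (k +ₙ b)) ⟩
      (w (k *ₙ b) - w (k *ₙ b +ₙ b)) + (w ((k +ₙ b) *ₙ b) - w ((k +ₙ b) *ₙ b +ₙ b))
        ≡⟨ cong₂ (λ x y → (w (k *ₙ b) - w (k *ₙ b +ₙ b)) + (x - y))
                 (periodic-≡ pw 1 b (e₁ k b)) (periodic-≡ pw 1 b (e₂ k b)) ⟩
      (w (k *ₙ b) - w (k *ₙ b +ₙ b)) + (w (suc (k *ₙ b)) - w (suc (k *ₙ b +ₙ b)))
        ≡⟨ regroup (w (k *ₙ b)) (w (suc (k *ₙ b))) (w (k *ₙ b +ₙ b)) (w (suc (k *ₙ b +ₙ b))) ⟩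
      (w (k *ₙ b) + w (suc (k *ₙ b))) - (w (k *ₙ b +ₙ b) + w (suc (k *ₙ b +ₙ b)))
        ≡⟨ cong₂ _-_ (M-adjacent p (k *ₙ b)) (M-adjacent p (k *ₙ b +ₙ b)) ⟩
      (u (k *ₙ b *ₙ b +ₙ b) - u (k *ₙ b *ₙ b +ₙ b +ₙ b))
        - (u ((k *ₙ b +ₙ b) *ₙ b +ₙ b) - u ((k *ₙ b +ₙ b) *ₙ b +ₙ b +ₙ b))
        ≡⟨ cong₂ _-_
             (cong₂ _-_ (periodic-≡ p k (k *ₙ b) (e₃ k b)) (periodic-≡ p k (k *ₙ b) (e₄ k b)))
             (cong₂ _-_ (periodic-≡ p (suc k) (k *ₙ b +ₙ b +ₙ 1) (e₅ k b))
                        (periodic-≡ p (suc k) (k *ₙ b +ₙ b +ₙ 1) (e₆ k b))) ⟩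
      (u (k +ₙ b) - u (k +ₙ b +ₙ b)) - (u k - u (k +ₙ b))
        ≡⟨ negate (u k) (u (k +ₙ b)) (u (k +ₙ b +ₙ b)) ⟩
      - 1-σ (1-σ u) k
        ∎
      where
      open ≡-Reasoning
      w = M u
      pw = M-periodic p
      regroup : ∀ a a′ c c′ → (a - c) + (a′ - c′) ≡ (a + a′) - (c + c′)
      regroup = solve-∀
      negate : ∀ x y z → (y - z) - (x - y) ≡ - ((x - y) - (y - z))
      negate = solve-∀
      e₁ : ∀ k b → (k +ₙ b) *ₙ b +ₙ 1 *ₙ (1 +ₙ b) ≡ 1 +ₙ k *ₙ b +ₙ b *ₙ (1 +ₙ b)
      e₁ = ℕ-Solver.solve-∀
      e₂ : ∀ k b → (k +ₙ b) *ₙ b +ₙ b +ₙ 1 *ₙ (1 +ₙ b) ≡ 1 +ₙ (k *ₙ b +ₙ b) +ₙ b *ₙ (1 +ₙ b)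
      e₂ = ℕ-Solver.solve-∀
      e₃ : ∀ k b → k *ₙ b *ₙ b +ₙ b +ₙ k *ₙ (1 +ₙ b) ≡ k +ₙ b +ₙ k *ₙ b *ₙ (1 +ₙ b)
      e₃ = ℕ-Solver.solve-∀
      e₄ : ∀ k b → k *ₙ b *ₙ b +ₙ b +ₙ b +ₙ k *ₙ (1 +ₙ b) ≡ k +ₙ b +ₙ b +ₙ k *ₙ b *ₙ (1 +ₙ b)
      e₄ = ℕ-Solver.solve-∀
      e₅ : ∀ k b → (k *ₙ b +ₙ b) *ₙ b +ₙ b +ₙ (1 +ₙ k) *ₙ (1 +ₙ b) ≡ k +ₙ (k *ₙ b +ₙ b +ₙ 1) *ₙ (1 +ₙ b)
      e₅ = ℕ-Solver.solve-∀
      e₆ : ∀ k b → (k *ₙ b +ₙ b) *ₙ b +ₙ b +ₙ b +ₙ (1 +ₙ k) *ₙ (1 +ₙ b)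
                   ≡ k +ₙ b +ₙ (k *ₙ b +ₙ b +ₙ 1) *ₙ (1 +ₙ b)
      e₆ = ℕ-Solver.solve-∀

    1+σ-kernel : ∀ {u} → Periodic u → (∀ k → 1+σ u k ≡ + 0) → ∀ k → u k ≡ + 0
    1+σ-kernel {u} p 1+σu≡0 k =
      trans (alternates k) (trans (cong (negOnePow k *_) u0≡0) (ℤₚ.*-zeroʳ (negOnePow k)))
      where
      flip : ∀ k → u (suc k) ≡ - u k
      flip k = ℤₚ.i-j≡0⇒i≡j (u (suc k)) (- u k) (trans
        (cong (_+_ (u (suc k))) (trans (ℤₚ.neg-involutive (u k)) (sym (σ-suc p k))))
        (1+σu≡0 (suc k)))
      alternates : ∀ k → u k ≡ negOnePow k * u 0
      alternates zero    = sym (ℤₚ.*-identityˡ (u 0))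
      alternates (suc k) = trans (flip k)
        (trans (cong -_ (alternates k)) (ℤₚ.neg-distribˡ-* (negOnePow k) (u 0)))
      double : ∀ x → + 2 * x ≡ x + x
      double = solve-∀
      -- n is odd, so going once around the period flips the sign of u 0.
      u0≡0 : u 0 ≡ + 0
      u0≡0 = ℤₚ.*-cancelˡ-≡ (+ 2) (u 0) (+ 0) (trans (double (u 0)) (trans
        (cong (_+_ (u 0)) (sym (trans (alternates b)
          (trans (cong (_* u 0) b-even) (ℤₚ.*-identityˡ (u 0))))))
        (1+σu≡0 0)))

    1-σ-kernel : ∀ {u} → Periodic u → (∀ k → 1-σ u k ≡ + 0) → ∀ k → u k ≡ u 0
    1-σ-kernel p 1-σu≡0 zero    = refl
    1-σ-kernel p 1-σu≡0 (suc k) = trans (ℤₚ.i-j≡0⇒i≡j _ _ (1-σu≡0 (suc k)))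
                                        (trans (σ-suc p k) (1-σ-kernel p 1-σu≡0 k))

    1+σ^ : ℕ → Seq → Seq
    1+σ^ zero    u = u
    1+σ^ (suc N) u = 1+σ (1+σ^ N u)

    1+σ^-cong : ∀ N {u w} → u ≗ w → 1+σ^ N u ≗ 1+σ^ N w
    1+σ^-cong zero    u≗w = u≗w
    1+σ^-cong (suc N) u≗w = 1+σ-cong (1+σ^-cong N u≗w)

    1+σ^-periodic : ∀ N {u} → Periodic u → Periodic (1+σ^ N u)
    1+σ^-periodic zero    p = p
    1+σ^-periodic (suc N) p = 1+σ-periodic (1+σ^-periodic N p)

    1+σ^-+ : ∀ N u w → 1+σ^ N (λ i → u i + w i) ≗ λ k → 1+σ^ N u k + 1+σ^ N w k
    1+σ^-+ zero    u w k = refl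
    1+σ^-+ (suc N) u w k = trans (1+σ-cong (1+σ^-+ N u w) k)
      (interchange (1+σ^ N u k) (1+σ^ N w k) (1+σ^ N u (k +ₙ b)) (1+σ^ N w (k +ₙ b)))
      where
      interchange : ∀ a b c d → (a + b) + (c + d) ≡ (a + c) + (b + d)
      interchange = solve-∀

    1+σ^-commute : (L : Seq → Seq) → (∀ {u w} → u ≗ w → L u ≗ L w) →
                   (∀ u → L (1+σ u) ≗ 1+σ (L u)) → ∀ N u → 1+σ^ N (L u) ≗ L (1+σ^ N u)
    1+σ^-commute L L-cong L-1+σ zero    u k = refl
    1+σ^-commute L L-cong L-1+σ (suc N) u k =
      trans (1+σ-cong (1+σ^-commute L L-cong L-1+σ N u) k) (sym (L-1+σ (1+σ^ N u) k))

    1+σ^-neg : ∀ N u → 1+σ^ N (λ i → - u i) ≗ λ k → - 1+σ^ N u k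
    1+σ^-neg = 1+σ^-commute (λ u k → - u k) (λ u≗w k → cong -_ (u≗w k))
                            (λ u k → ℤₚ.neg-distrib-+ (u k) (u (k +ₙ b)))

    1+σ^-1-σ : ∀ N u → 1+σ^ N (1-σ u) ≗ 1-σ (1+σ^ N u)
    1+σ^-1-σ = 1+σ^-commute 1-σ 1-σ-cong 1-σ-1+σ

    1+σ^-1+σ² : ∀ N u → 1+σ^ N (1+σ (1+σ u)) ≗ 1+σ^ (2 +ₙ N) u
    1+σ^-1+σ² = 1+σ^-commute (λ u → 1+σ (1+σ u)) (λ u≗w → 1+σ-cong (1+σ-cong u≗w)) (λ u k → refl)

    sumBelow-σ : ∀ {u} → Periodic u → sumBelow n (σ u) ≡ sumBelow n u
    sumBelow-σ {u} p = begin
      sumBelow (suc b) (σ u)                  ≡⟨ sumBelow-suc b (σ u) ⟩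
      u b + sumBelow b (λ k → σ u (suc k))    ≡⟨ cong (_+_ (u b)) (sumBelow-cong b (σ-suc p)) ⟩
      u b + sumBelow b u                      ≡⟨ ℤₚ.+-comm (u b) (sumBelow b u) ⟩
      sumBelow n u                            ∎
      where open ≡-Reasoning

    sumBelow-1+σ : ∀ {u} → Periodic u → sumBelow n (1+σ u) ≡ + 2 * sumBelow n u
    sumBelow-1+σ {u} p = trans (sumBelow-+ n u (σ u))
      (trans (cong (_+_ (sumBelow n u)) (sumBelow-σ p)) (double (sumBelow n u)))
      where
      double : ∀ x → x + x ≡ + 2 * x
      double = solve-∀

    sumBelow-1-σ : ∀ {u} → Periodic u → sumBelow n (1-σ u) ≡ + 0
    sumBelow-1-σ {u} p = trans (sumBelow-+ n u (λ k → - σ u k))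
      (trans (cong (_+_ (sumBelow n u)) (trans (sumBelow-neg n (σ u)) (cong -_ (sumBelow-σ p))))
             (ℤₚ.+-inverseʳ (sumBelow n u)))

    sumBelow-M² : ∀ {u} → Periodic u → sumBelow n (M (M u)) ≡ + 0
    sumBelow-M² {u} p = ℤₚ.*-cancelˡ-≡ (+ 4) _ (+ 0) (begin
      + 4 * sumBelow n (M (M u))              ≡⟨ quadruple _ ⟩
      + 2 * (+ 2 * sumBelow n (M (M u)))      ≡⟨ cong (_*_ (+ 2)) (sumBelow-1+σ pM²) ⟨
      + 2 * sumBelow n (1+σ (M (M u)))        ≡⟨ sumBelow-1+σ (1+σ-periodic pM²) ⟨
      sumBelow n (1+σ (1+σ (M (M u))))        ≡⟨ sumBelow-cong n (cayley p) ⟩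
      sumBelow n (λ k → - 1-σ (1-σ u) k)      ≡⟨ sumBelow-neg n (1-σ (1-σ u)) ⟩
      - sumBelow n (1-σ (1-σ u))              ≡⟨ cong -_ (sumBelow-1-σ (1-σ-periodic p)) ⟩
      + 0                                     ∎)
      where
      open ≡-Reasoning
      pM² = M-periodic (M-periodic p)
      quadruple : ∀ x → + 4 * x ≡ + 2 * (+ 2 * x)
      quadruple = solve-∀

    n∤[1+k]b : ∀ {k} → k < b → ¬ n ∣ suc k *ₙ b
    n∤[1+k]b {k} k<b n∣[1+k]b = ℕₚ.<⇒≱ (s≤s k<b) (∣⇒≤ (∣m+n∣m⇒∣n n∣[1+k]n n∣[1+k]b))
      where
      n∣[1+k]n : n ∣ suc k *ₙ b +ₙ suc k
      n∣[1+k]n = subst (n ∣_) (sym (eq k b)) (n∣m*n (suc k))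
        where
        eq : ∀ k b → (1 +ₙ k) *ₙ b +ₙ (1 +ₙ k) ≡ (1 +ₙ k) *ₙ (1 +ₙ b)
        eq = ℕ-Solver.solve-∀

    sumBelow-v0 : sumBelow n (v 0) ≡ + 1
    sumBelow-v0 = begin
      sumBelow n (v 0)                          ≡⟨ sumBelow-suc b (v 0) ⟩
      + 1 + sumBelow b (λ k → v 0 (suc k))      ≡⟨ cong (_+_ (+ 1)) (sumBelow-cong< b v0-off) ⟩
      + 1 + sumBelow b (λ _ → + 0)              ≡⟨ cong (_+_ (+ 1)) (sumBelow-zero b) ⟩
      + 1                                       ∎
      where
      open ≡-Reasoning
      v0-off : ∀ k → k < b → v 0 (suc k) ≡ + 0
      v0-off k k<b = trans (ℤₚ.+-identityˡ _)
        (ifMultiple-∤ (+ 1) (subst (λ x → ¬ n ∣ x) (sym (ℕₚ.+-identityʳ _)) (n∤[1+k]b k<b)))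

    -- Since v (2 j) = M^(2 j) (v 0), A N + i M (B N) is (1 + i M)^N (v 0).
    A B : ℕ → Seq
    A N k = evenBinomialSum N (λ j → v (2 *ₙ j) k)
    B N k = oddBinomialSum  N (λ j → v (2 *ₙ j) k)

    A-periodic : ∀ N → Periodic (A N)
    A-periodic N k = sumBelow-cong (suc N)
      (λ j → cong (λ y → negOnePow j * (+ (N C (2 *ₙ j)) * y)) (v-periodic (2 *ₙ j) k))

    B-periodic : ∀ N → Periodic (B N)
    B-periodic N k = sumBelow-cong (suc N)
      (λ j → cong (λ y → negOnePow j * (+ (N C (2 *ₙ j +ₙ 1)) * y)) (v-periodic (2 *ₙ j) k))

    v-2suc : ∀ j → v (2 *ₙ suc j) ≗ M (M (v (2 *ₙ j)))
    v-2suc j k = trans (cong (λ N → v N k) (trans (2[1+j]≡1+[2j+1] j) (cong suc (2j+1≡1+2j j))))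
                       (trans (v-suc (suc (2 *ₙ j)) k) (M-cong (v-suc (2 *ₙ j)) k))

    M-weightedSum : ∀ K (s c : ℕ → ℤ) (F : ℕ → Seq) →
      M (λ i → sumBelow K (λ j → s j * (c j * F j i)))
        ≗ λ k → sumBelow K (λ j → s j * (c j * M (F j) k))
    M-weightedSum K s c F k = begin
      sumBelow b (λ d → negOnePow d * sumBelow K (λ j → s j * (c j * F j (k *ₙ b +ₙ d))))
        ≡⟨ sumBelow-cong b (λ d → sumBelow-*ˡ K (negOnePow d) _) ⟨
      sumBelow b (λ d → sumBelow K (λ j → negOnePow d * (s j * (c j * F j (k *ₙ b +ₙ d)))))
        ≡⟨ sumBelow-swap b K _ ⟩
      sumBelow K (λ j → sumBelow b (λ d → negOnePow d * (s j * (c j * F j (k *ₙ b +ₙ d)))))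
        ≡⟨ sumBelow-cong K (λ j → sumBelow-cong b (λ d → reorder (negOnePow d) (s j) (c j) _)) ⟩
      sumBelow K (λ j → sumBelow b (λ d → s j * (c j * (negOnePow d * F j (k *ₙ b +ₙ d)))))
        ≡⟨ sumBelow-cong K (λ j →
             trans (sumBelow-*ˡ b (s j) _) (cong (_*_ (s j)) (sumBelow-*ˡ b (c j) _))) ⟩
      sumBelow K (λ j → s j * (c j * M (F j) k))
        ∎
      where
      open ≡-Reasoning
      reorder : ∀ e s c x → e * (s * (c * x)) ≡ s * (c * (e * x))
      reorder = solve-∀

    M²-B : ∀ N → M (M (B N)) ≗ λ k → oddBinomialSum N (λ j → v (2 *ₙ suc j) k)
    M²-B N k = begin
      M (M (B N)) k
        ≡⟨ M-cong (M-weightedSum (suc N) negOnePow c (λ j → v (2 *ₙ j))) k ⟩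
      M (λ i → sumBelow (suc N) (λ j → negOnePow j * (c j * M (v (2 *ₙ j)) i))) k
        ≡⟨ M-weightedSum (suc N) negOnePow c (λ j → M (v (2 *ₙ j))) k ⟩
      sumBelow (suc N) (λ j → negOnePow j * (c j * M (M (v (2 *ₙ j))) k))
        ≡⟨ sumBelow-cong (suc N) (λ j → cong (λ y → negOnePow j * (c j * y)) (v-2suc j k)) ⟨
      oddBinomialSum N (λ j → v (2 *ₙ suc j) k)
        ∎
      where
      open ≡-Reasoning
      c : ℕ → ℤ
      c j = + (N C (2 *ₙ j +ₙ 1))

    A-suc : ∀ N → A (suc N) ≗ λ k → A N k - M (M (B N)) k
    A-suc N k = trans (evenBinomialSum-suc N (λ j → v (2 *ₙ j) k)) (cong (_-_ (A N k)) (sym (M²-B N k)))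

    B-suc : ∀ N → B (suc N) ≗ λ k → B N k + A N k
    B-suc N k = oddBinomialSum-suc N (λ j → v (2 *ₙ j) k)

    sumBelow-A : ∀ N → sumBelow n (A N) ≡ + 1
    sumBelow-A zero    = trans (sumBelow-cong n (λ k → unit (v 0 k))) sumBelow-v0
      where
      unit : ∀ x → + 0 + + 1 * (+ 1 * x) ≡ x
      unit = solve-∀
    sumBelow-A (suc N) = begin
      sumBelow n (A (suc N))
        ≡⟨ sumBelow-cong n (A-suc N) ⟩
      sumBelow n (λ k → A N k + - M (M (B N)) k)
        ≡⟨ sumBelow-+ n (A N) (λ k → - M (M (B N)) k) ⟩
      sumBelow n (A N) + sumBelow n (λ k → - M (M (B N)) k)
        ≡⟨ cong₂ _+_ (sumBelow-A N) (sumBelow-neg n (M (M (B N)))) ⟩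
      + 1 - sumBelow n (M (M (B N)))
        ≡⟨ cong (_-_ (+ 1)) (sumBelow-M² (B-periodic N)) ⟩
      + 1
        ∎
      where open ≡-Reasoning

    sumBelow-B : ∀ N → sumBelow n (B N) ≡ + N
    sumBelow-B zero    = sumBelow-zero n
    sumBelow-B (suc N) = begin
      sumBelow n (B (suc N))               ≡⟨ sumBelow-cong n (B-suc N) ⟩
      sumBelow n (λ k → B N k + A N k)     ≡⟨ sumBelow-+ n (B N) (A N) ⟩
      sumBelow n (B N) + sumBelow n (A N)  ≡⟨ cong₂ _+_ (sumBelow-B N) (sumBelow-A N) ⟩
      + (N +ₙ 1)                           ≡⟨ cong +_ (ℕₚ.+-comm N 1) ⟩
      + suc N                              ∎
      where open ≡-Reasoning

    -- By cayley, M acts as ± i (1 - σ) / (1 + σ), so E N ± Q N = (1 + σ)^(N+1) (A N ± i M (B N))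
    -- = (1 + σ) (1 + σ ± (1 - σ))^N (v 0): the sum evolves by the factor 2, the difference by 2 σ.
    E Q : ℕ → Seq
    E N = 1+σ^ (suc N) (A N)
    Q N = 1-σ (1+σ^ N (B N))

    E-suc : ∀ N k → E (suc N) k ≡ 1+σ (E N) k + 1-σ (Q N) k
    E-suc N k = begin
      1+σ^ (2 +ₙ N) (A (suc N)) k
        ≡⟨ 1+σ^-cong (2 +ₙ N) (A-suc N) k ⟩
      1+σ^ (2 +ₙ N) (λ i → A N i + - M (M (B N)) i) k
        ≡⟨ 1+σ^-+ (2 +ₙ N) (A N) (λ i → - M (M (B N)) i) k ⟩
      1+σ (E N) k + 1+σ^ (2 +ₙ N) (λ i → - M (M (B N)) i) k
        ≡⟨ cong (_+_ (1+σ (E N) k)) cayleyTerm ⟩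
      1+σ (E N) k + 1-σ (Q N) k
        ∎
      where
      open ≡-Reasoning
      cayleyTerm : 1+σ^ (2 +ₙ N) (λ i → - M (M (B N)) i) k ≡ 1-σ (Q N) k
      cayleyTerm = begin
        1+σ^ (2 +ₙ N) (λ i → - M (M (B N)) i) k   ≡⟨ 1+σ^-neg (2 +ₙ N) (M (M (B N))) k ⟩
        - 1+σ^ (2 +ₙ N) (M (M (B N))) k            ≡⟨ cong -_ (1+σ^-1+σ² N (M (M (B N))) k) ⟨
        - 1+σ^ N (1+σ (1+σ (M (M (B N))))) k       ≡⟨ cong -_ (1+σ^-cong N (cayley (B-periodic N)) k) ⟩
        - 1+σ^ N (λ i → - 1-σ (1-σ (B N)) i) k     ≡⟨ cong -_ (1+σ^-neg N (1-σ (1-σ (B N))) k) ⟩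
        - - 1+σ^ N (1-σ (1-σ (B N))) k             ≡⟨ ℤₚ.neg-involutive _ ⟩
        1+σ^ N (1-σ (1-σ (B N))) k                 ≡⟨ 1+σ^-1-σ N (1-σ (B N)) k ⟩
        1-σ (1+σ^ N (1-σ (B N))) k                 ≡⟨ 1-σ-cong (1+σ^-1-σ N (B N)) k ⟩
        1-σ (Q N) k                                ∎

    Q-suc : ∀ N k → Q (suc N) k ≡ 1+σ (Q N) k + 1-σ (E N) k
    Q-suc N k = begin
      1-σ (1+σ^ (suc N) (B (suc N))) k
        ≡⟨ 1-σ-cong (1+σ^-cong (suc N) (B-suc N)) k ⟩
      1-σ (1+σ^ (suc N) (λ i → B N i + A N i)) k
        ≡⟨ 1-σ-cong (1+σ^-+ (suc N) (B N) (A N)) k ⟩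
      1-σ (λ i → 1+σ (1+σ^ N (B N)) i + E N i) k
        ≡⟨ interchange (1+σ (1+σ^ N (B N)) k) (E N k) (1+σ (1+σ^ N (B N)) (k +ₙ b)) (E N (k +ₙ b)) ⟩
      1-σ (1+σ (1+σ^ N (B N))) k + 1-σ (E N) k
        ≡⟨ cong (_+ 1-σ (E N) k) (1-σ-1+σ (1+σ^ N (B N)) k) ⟩
      1+σ (Q N) k + 1-σ (E N) k
        ∎
      where
      open ≡-Reasoning
      interchange : ∀ a b c d → (a + b) - (c + d) ≡ (a - c) + (b - d)
      interchange = solve-∀

    E+Q : ∀ N k → E N k + Q N k ≡ (+ 2) ^ N * (E 0 k + Q 0 k)
    E+Q zero    k = sym (ℤₚ.*-identityˡ _)
    E+Q (suc N) k = begin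
      E (suc N) k + Q (suc N) k
        ≡⟨ cong₂ _+_ (E-suc N k) (Q-suc N k) ⟩
      (1+σ (E N) k + 1-σ (Q N) k) + (1+σ (Q N) k + 1-σ (E N) k)
        ≡⟨ doubling (E N k) (E N (k +ₙ b)) (Q N k) (Q N (k +ₙ b)) ⟩
      + 2 * (E N k + Q N k)
        ≡⟨ cong (_*_ (+ 2)) (E+Q N k) ⟩
      + 2 * ((+ 2) ^ N * (E 0 k + Q 0 k))
        ≡⟨ ℤₚ.*-assoc (+ 2) ((+ 2) ^ N) _ ⟨
      (+ 2) ^ suc N * (E 0 k + Q 0 k)
        ∎
      where
      open ≡-Reasoning
      doubling : ∀ e e′ q q′ → ((e + e′) + (q - q′)) + ((q + q′) + (e - e′)) ≡ + 2 * (e + q)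
      doubling = solve-∀

    E-Q : ∀ N k → E N k - Q N k ≡ (+ 2) ^ N * (E 0 (k +ₙ N *ₙ b) - Q 0 (k +ₙ N *ₙ b))
    E-Q zero    k rewrite ℕₚ.+-identityʳ k = sym (ℤₚ.*-identityˡ _)
    E-Q (suc N) k = begin
      E (suc N) k - Q (suc N) k
        ≡⟨ cong₂ _-_ (E-suc N k) (Q-suc N k) ⟩
      (1+σ (E N) k + 1-σ (Q N) k) - (1+σ (Q N) k + 1-σ (E N) k)
        ≡⟨ shifting (E N k) (E N (k +ₙ b)) (Q N k) (Q N (k +ₙ b)) ⟩
      + 2 * (E N (k +ₙ b) - Q N (k +ₙ b))
        ≡⟨ cong (_*_ (+ 2)) (E-Q N (k +ₙ b)) ⟩
      + 2 * ((+ 2) ^ N * (E 0 (k +ₙ b +ₙ N *ₙ b) - Q 0 (k +ₙ b +ₙ N *ₙ b)))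
        ≡⟨ ℤₚ.*-assoc (+ 2) ((+ 2) ^ N) _ ⟨
      (+ 2) ^ suc N * (E 0 (k +ₙ b +ₙ N *ₙ b) - Q 0 (k +ₙ b +ₙ N *ₙ b))
        ≡⟨ cong (λ x → (+ 2) ^ suc N * (E 0 x - Q 0 x)) (ℕₚ.+-assoc k b (N *ₙ b)) ⟩
      (+ 2) ^ suc N * (E 0 (k +ₙ suc N *ₙ b) - Q 0 (k +ₙ suc N *ₙ b))
        ∎
      where
      open ≡-Reasoning
      shifting : ∀ e e′ q q′ → ((e + e′) + (q - q′)) - ((q + q′) + (e - e′)) ≡ + 2 * (e′ - q′)
      shifting = solve-∀

    -- σ^n is the identity on periodic sequences, so the two evolutions agree after n steps.
    Q-modulus≡0 : ∀ k → Q n k ≡ + 0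
    Q-modulus≡0 k = ℤₚ.*-cancelˡ-≡ (+ 2) (Q n k) (+ 0) (begin
      + 2 * Q n k                                          ≡⟨ halves (E n k) (Q n k) ⟩
      (E n k + Q n k) - (E n k - Q n k)                    ≡⟨ cong₂ _-_ (E+Q n k) (E-Q n k) ⟩
      (+ 2) ^ n * (E 0 k + + 0) - (+ 2) ^ n * (E 0 (k +ₙ n *ₙ b) - + 0)
        ≡⟨ cong (λ x → (+ 2) ^ n * (E 0 k + + 0) - (+ 2) ^ n * (x - + 0)) E₀-periodic ⟩
      (+ 2) ^ n * (E 0 k + + 0) - (+ 2) ^ n * (E 0 k - + 0) ≡⟨ cancel ((+ 2) ^ n) (E 0 k) ⟩
      + 0                                                  ∎)
      where
      open ≡-Reasoning
      halves : ∀ e q → + 2 * q ≡ (e + q) - (e - q)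
      halves = solve-∀
      cancel : ∀ c e → c * (e + + 0) - c * (e - + 0) ≡ + 0
      cancel = solve-∀
      E₀-periodic : E 0 (k +ₙ n *ₙ b) ≡ E 0 k
      E₀-periodic = trans (cong (E 0) (cong (k +ₙ_) (ℕₚ.*-comm n b)))
                          (periodic-+* (1+σ-periodic (A-periodic 0)) k b)

    B-modulus-constant : ∀ k → B n k ≡ B n 0
    B-modulus-constant = 1-σ-kernel (B-periodic n)
      (1+σ^-kernel n (1-σ-periodic (B-periodic n))
        (λ k → trans (1+σ^-1-σ n (B n) k) (Q-modulus≡0 k)))
      where
      1+σ^-kernel : ∀ N {u} → Periodic u → (∀ k → 1+σ^ N u k ≡ + 0) → ∀ k → u k ≡ + 0
      1+σ^-kernel zero    p h = h
      1+σ^-kernel (suc N) p h = 1+σ^-kernel N p (1+σ-kernel (1+σ^-periodic N p) h)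

    B-modulus≡1 : ∀ k → B n k ≡ + 1
    B-modulus≡1 k = trans (B-modulus-constant k) (ℤₚ.*-cancelˡ-≡ (+ n) (B n 0) (+ 1) (begin
      + n * B n 0                  ≡⟨ sumBelow-const n (B n 0) ⟨
      sumBelow n (λ _ → B n 0)     ≡⟨ sumBelow-cong n B-modulus-constant ⟨
      sumBelow n (B n)             ≡⟨ sumBelow-B n ⟩
      + n                          ≡⟨ ℤₚ.*-identityʳ (+ n) ⟨
      + n * + 1                    ∎))
      where open ≡-Reasoning

open import Data.Nat using (ℕ; suc; _+_; _*_; _^_)
open import Data.Integer using (ℤ; +_)
open import Data.Nat.Combinatorics using (_C_)
open import Relation.Binary.PropositionalEquality using (_≡_)
open import Data.Nat using (z≤n; s≤s)
open import Data.Nat.Tactic.RingSolver using (solve-∀)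
open import Relation.Binary.PropositionalEquality using (trans; cong)

mainTheorem3 : (m : ℕ) →
    sumBelow (2 + m) (λ j → negOnePow j Data.Integer.* ((+ ((3 + 2 * m) C (2 * j + 1))) Data.Integer.* S (3 + 2 * m) ((2 + 2 * m) ^ (2 * j)))) ≡ + 1
mainTheorem3 m = trans (oddBinomialSum-half n (2 + m) _ (half m)) (B-modulus≡1 0)
  where
  half : ∀ m → (2 + m) + (2 + m) ≡ suc (3 + 2 * m)
  half = solve-∀
  even : ∀ m → 2 + 2 * m ≡ 2 * suc m
  even = solve-∀
  open AlternatingDigitSums
  open OddModulus (2 + 2 * m) (s≤s (s≤s z≤n)) (trans (cong negOnePow (even m)) (negOnePow-2* (suc m)))
    using (n; B-modulus≡1)
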